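{- Let $n\ge 3$ and $k\ge 3$ be fixed integers. Then, for all integers $m\ge 0$, $$\nu_k(K_n)\ \ge\ \frac{m}{2}\,n(n-3)-k\sum_{\ell=0}^{m-1}e_\ell(n).$$
   Context: A $k$-page book consists of $k$ halfplanes (pages) with a common boundary line (the spine). A $k$-page book drawing of a graph $G$ is a drawing of $G$ in a $k$-page book in which all vertices lie on the spine and edges do not cross the spine (each edge lies in one page). The $k$-page book crossing number $\nu_k(G)$ is the minimum number of edge-crossings over all $k$-page book drawings of $G$. Equivalently (convex model), $\nu_k(K_n)$ is the minimum, over all colorings of the edges of the complete geometric graph on the $n$ vertices of a convex polygon with $k$ colors, of the number of monochromatic crossings, i.e. pairs of edges of the same color that cross in their interiors. $K_n$ is the complete graph on $n$ vertices. $D_n$ denotes the complete convex graph on $n$ vertices minus the sides of the polygon: its vertices are the vertices of a convex $n$-gon and its edges are all the diagonals (straight segments) of the polygon. For an integer $\ell\ge 0$, $e_\ell(n)$ is the maximum number of edges over all subgraphs of $D_n$ in which each edge is crossed at most $\ell$ times by other edges of the subgraph. -}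

module Defs where

open import Data.Bool.Base using (if_then_else_)
open import Data.Fin.Base using (Fin; toℕ; _<_) renaming (zero to fzero)
import Data.Fin.Properties as Fin
open import Data.Integer.Base using (+_)
open import Data.List.Base
  using (List; []; _∷_; _++_; map; filter; length; allFin; cartesianProduct; concatMap)
open import Data.List.Extrema.Nat using (argmin; argmax; f[argmin]≤f[xs]; f[xs]≤f[argmax]; argmax-all)
open import Data.List.Membership.Propositional using (_∈_)
open import Data.List.Membership.Propositional.Properties
  using (∈-map⁺; ∈-concatMap⁺; ∈-++⁺ˡ; ∈-++⁺ʳ; ∈-allFin; ∈-filter⁺; ∈-cartesianProduct⁻)
open import Data.List.Relation.Binary.Sublist.Propositional using (_⊆_; []; _∷_; _∷ʳ_; minimum)
open import Data.List.Relation.Unary.All as All using (All; []; _∷_; all?)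
import Data.List.Relation.Unary.All.Properties as All
open import Data.List.Relation.Unary.Any as Any using (here; there)
open import Data.Nat.Base as ℕ using (ℕ; zero; suc; NonZero; _≤_; z≤n)
import Data.Nat.Properties as ℕ
open import Data.Product.Base using (∃; _×_; _,_; proj₁; proj₂)
open import Data.Product.Properties using (≡-dec)
open import Data.Rational.Base using (ℚ)
open import Data.Rational.Literals using (fromℤ)
open import Data.Sum.Base using (_⊎_)
open import Relation.Binary.Definitions using (Decidable; DecidableEquality)
import Relation.Unary as U
open import Relation.Binary.PropositionalEquality
open import Relation.Nullary.Decidable using (yes; no; does; _×-dec_; _⊎-dec_; ¬?)
open import Relation.Nullary.Negation using (contradiction)

IsLeast : (ℕ → Set) → ℕ → Set
IsLeast P v = P v × (∀ w → P w → v ≤ w)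

IsGreatest : (ℕ → Set) → ℕ → Set
IsGreatest P v = P v × (∀ w → P w → w ≤ v)

-- The vertices of the convex n-gon are numbered 0, …, n-1 in cyclic order
-- (equivalently, in their order along the spine).  The segment joining
-- vertices i < j is encoded as the pair (i , j).

Segment : ℕ → Set
Segment n = Fin n × Fin n

edges : ∀ n → List (Segment n)
edges n = filter (λ (i , j) → i Fin.<? j) (cartesianProduct (allFin n) (allFin n))

-- Only meant for (i , j) with i < j.
Side : ∀ {n} → Segment n → Set
Side {n} (i , j) = suc (toℕ i) ≡ toℕ j ⊎ (toℕ i ≡ 0 × suc (toℕ j) ≡ n)

side? : ∀ {n} → U.Decidable (Side {n})
side? {n} (i , j) =
  (suc (toℕ i) ℕ.≟ toℕ j) ⊎-dec ((toℕ i ℕ.≟ 0) ×-dec (suc (toℕ j) ℕ.≟ n))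

diagonals : ∀ n → List (Segment n)
diagonals n = filter (λ d → ¬? (side? d)) (edges n)

-- Two segments with endpoints in convex position meet in their interiors iff
-- their endpoints alternate around the polygon.  Interleaves is the
-- asymmetric half of this relation, in which the first segment has the
-- smallest endpoint, so each crossing pair {d , e} satisfies it in exactly
-- one of its two orders.

Interleaves : ∀ {n} → Segment n → Segment n → Set
Interleaves (i , j) (k , l) = i < k × k < j × j < l

interleaves? : ∀ {n} → Decidable (Interleaves {n})
interleaves? (i , j) (k , l) = (i Fin.<? k) ×-dec ((k Fin.<? j) ×-dec (j Fin.<? l))

Crosses : ∀ {n} → Segment n → Segment n → Set
Crosses d e = Interleaves d e ⊎ Interleaves e d

crosses? : ∀ {n} → Decidable (Crosses {n})
crosses? d e = interleaves? d e ⊎-dec interleaves? e d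

-- A colouring is only ever evaluated at elements of edges n.
Colouring : ℕ → ℕ → Set
Colouring k n = Segment n → Fin k

MonochromaticCrossing : ∀ {k n} → Colouring k n → Segment n × Segment n → Set
MonochromaticCrossing c (d , e) = Interleaves d e × c d ≡ c e

monochromaticCrossing? : ∀ {k n} (c : Colouring k n) → U.Decidable (MonochromaticCrossing c)
monochromaticCrossing? c (d , e) = interleaves? d e ×-dec (c d Fin.≟ c e)

#monochromatic : ∀ {k n} → Colouring k n → ℕ
#monochromatic {n = n} c =
  length (filter (monochromaticCrossing? c) (cartesianProduct (edges n) (edges n)))

IsBookCrossingNumber : ℕ → ℕ → ℕ → Set
IsBookCrossingNumber k n = IsLeast (λ v → ∃ λ (c : Colouring k n) → #monochromatic c ≡ v)

#crossing : ∀ {n} → Segment n → List (Segment n) → ℕ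
#crossing d G = length (filter (crosses? d) G)

-- Subgraphs of D_n are given by their edge sets, that is, by the sublists of
-- the repetition-free list diagonals n.
AtMostCrossed : ∀ {n} → ℕ → List (Segment n) → Set
AtMostCrossed ℓ G = All (λ d → #crossing d G ≤ ℓ) G

IsMaxEdges : ℕ → ℕ → ℕ → Set
IsMaxEdges ℓ n =
  IsGreatest (λ s → ∃ λ G → G ⊆ diagonals n × AtMostCrossed ℓ G × length G ≡ s)

------------------------------------------------------------------------
-- Existence of the minimum

private
  _≟ˢ_ : ∀ {n} → DecidableEquality (Segment n)
  _≟ˢ_ = ≡-dec Fin._≟_ Fin._≟_

  update : ∀ {k n} → Segment n → Colouring k n → Fin k → Colouring k n
  update d c a e = if does (e ≟ˢ d) then a else c e

  -- Colourings realising every assignment of colours to the given segments.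
  colourings : ∀ {k n} → Colouring k n → List (Segment n) → List (Colouring k n)
  colourings c₀ []       = c₀ ∷ []
  colourings c₀ (d ∷ ds) = concatMap (λ c → map (update d c) (allFin _)) (colourings c₀ ds)

  represented : ∀ {k n} (c₀ c : Colouring k n) ds →
                ∃ λ c′ → c′ ∈ colourings c₀ ds × (∀ {e} → e ∈ ds → c′ e ≡ c e)
  represented c₀ c [] = c₀ , here refl , λ ()
  represented c₀ c (d ∷ ds) with represented c₀ c ds
  ... | c′ , c′∈ , agree =
    update d c′ (c d) ,
    ∈-concatMap⁺ (λ c → map (update d c) (allFin _))
      (Any.map (λ { refl → ∈-map⁺ (update d c′) (∈-allFin (c d)) }) c′∈) ,
    agree′
    where
    agree′ : ∀ {e} → e ∈ d ∷ ds → update d c′ (c d) e ≡ c e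
    agree′ {e} e∈ with e ≟ˢ d
    agree′ {e} e∈         | yes refl = refl
    agree′ {e} (here e≡d) | no  e≢d  = contradiction e≡d e≢d
    agree′ {e} (there e∈) | no  _    = agree e∈

  filter-cong : ∀ {A : Set} {P Q : A → Set} (P? : U.Decidable P) (Q? : U.Decidable Q) xs →
                (∀ {x} → x ∈ xs → (P x → Q x) × (Q x → P x)) → filter P? xs ≡ filter Q? xs
  filter-cong P? Q? []       _   = refl
  filter-cong P? Q? (x ∷ xs) P⇔Q with P? x | Q? x
  ... | yes _  | yes _  = cong (x ∷_) (filter-cong P? Q? xs (λ x∈ → P⇔Q (there x∈)))
  ... | no  _  | no  _  = filter-cong P? Q? xs (λ x∈ → P⇔Q (there x∈))
  ... | yes p  | no  ¬q = contradiction (proj₁ (P⇔Q (here refl)) p) ¬q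
  ... | no  ¬p | yes q  = contradiction (proj₂ (P⇔Q (here refl)) q) ¬p

#monochromatic-cong : ∀ {k n} (c c′ : Colouring k n) → (∀ {e} → e ∈ edges n → c e ≡ c′ e) →
                      #monochromatic c ≡ #monochromatic c′
#monochromatic-cong {n = n} c c′ eq =
  cong length (filter-cong (monochromaticCrossing? c) (monochromaticCrossing? c′) _ λ {x} x∈ →
    let d∈ , e∈ = ∈-cartesianProduct⁻ (edges n) (edges n) x∈ in
    (λ (I , same) → I , trans (sym (eq d∈)) (trans same (eq e∈))) ,
    (λ (I , same) → I , trans (eq d∈) (trans same (sym (eq e∈)))))

bookCrossingNumber-exists : ∀ k .{{_ : NonZero k}} n → ∃ (IsBookCrossingNumber k n)
bookCrossingNumber-exists (suc k) n = #monochromatic best , (best , refl) , minimal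
  where
  c₀ : Colouring (suc k) n
  c₀ _ = fzero
  candidates = colourings c₀ (edges n)
  best = argmin #monochromatic c₀ candidates
  minimal : ∀ w → (∃ λ c → #monochromatic c ≡ w) → #monochromatic best ≤ w
  minimal _ (c , refl) with represented c₀ c (edges n)
  ... | c′ , c′∈ , agree = ℕ.≤-trans
    (All.lookup (f[argmin]≤f[xs] {f = #monochromatic} c₀ candidates) c′∈)
    (ℕ.≤-reflexive (#monochromatic-cong c′ c agree))

------------------------------------------------------------------------
-- Existence of the maximum

private
  sublists : ∀ {A : Set} → List A → List (List A)
  sublists []       = [] ∷ []
  sublists (x ∷ xs) = sublists xs ++ map (x ∷_) (sublists xs)

  ∈-sublists⁺ : ∀ {A : Set} {xs ys : List A} → xs ⊆ ys → xs ∈ sublists ys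
  ∈-sublists⁺ []         = here refl
  ∈-sublists⁺ (y ∷ʳ p)   = ∈-++⁺ˡ (∈-sublists⁺ p)
  ∈-sublists⁺ {ys = y ∷ ys} (refl ∷ p) = ∈-++⁺ʳ (sublists ys) (∈-map⁺ (y ∷_) (∈-sublists⁺ p))

  sublists-⊆ : ∀ {A : Set} (ys : List A) → All (_⊆ ys) (sublists ys)
  sublists-⊆ []       = [] ∷ []
  sublists-⊆ (y ∷ ys) = All.++⁺ (All.map (y ∷ʳ_) (sublists-⊆ ys))
                                (All.map⁺ (All.map (refl ∷_) (sublists-⊆ ys)))

atMostCrossed? : ∀ {n} ℓ → U.Decidable (AtMostCrossed {n} ℓ)
atMostCrossed? ℓ G = all? (λ d → #crossing d G ℕ.≤? ℓ) G

maxEdges-exists : ∀ ℓ n → ∃ (IsMaxEdges ℓ n)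
maxEdges-exists ℓ n =
  length best , (best , proj₁ best-ok , proj₂ best-ok , refl) , maximal
  where
  candidates = filter (atMostCrossed? ℓ) (sublists (diagonals n))
  best = argmax length [] candidates
  best-ok : best ⊆ diagonals n × AtMostCrossed ℓ best
  best-ok = argmax-all length {P = λ G → G ⊆ diagonals n × AtMostCrossed ℓ G}
    (minimum _ , [])
    (All.zip (All.filter⁺ (atMostCrossed? ℓ) (sublists-⊆ (diagonals n)) ,
              All.all-filter (atMostCrossed? ℓ) (sublists (diagonals n))))
  maximal : ∀ w → (∃ λ G → G ⊆ diagonals n × AtMostCrossed ℓ G × length G ≡ w) → w ≤ length best
  maximal _ (G , G⊆ , G-ok , refl) =
    All.lookup (f[xs]≤f[argmax] {f = length} [] candidates)
      (∈-filter⁺ (atMostCrossed? ℓ) (∈-sublists⁺ G⊆) G-ok)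

------------------------------------------------------------------------

ν : ∀ k .{{_ : NonZero k}} → ℕ → ℕ
ν k n = proj₁ (bookCrossingNumber-exists k n)

e : ℕ → ℕ → ℕ
e ℓ n = proj₁ (maxEdges-exists ℓ n)

fromℕ : ℕ → ℚ
fromℕ n = fromℤ (+ n)

{-# OPTIONS --safe #-}
module Submission where

-- For a set G of diagonals coloured with k colours,
--   #(monochromatic crossings in G) ≥ m |G| − k Σ_{ℓ<m} e_ℓ(n),
-- by induction on m and on |G|.  If some edge of G takes part in at least m
-- monochromatic crossings, delete it.  Otherwise each edge is crossed at most
-- m − 1 times within its colour class, so |G| ≤ k e_{m−1}(n), and this is
-- added to the inequality for m − 1.  Take G = D_n, with |D_n| = n(n−3)/2.

open import Defs
open import Data.Nat.Base using (ℕ; NonZero; _≤_)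
open import Data.Integer.Base using (+_)
open import Data.List.Base using (map; sum; upTo)
open import Data.Rational.Base using (_/_; _*_; _-_; _≥_)
open import Data.Fin.Base as Fin using (Fin; toℕ; inject₁)
import Data.Fin.Properties as Fin
import Data.Integer.Base as ℤ
import Data.Integer.Properties as ℤ
open import Data.List.Base
  using (List; []; _∷_; _++_; [_]; filter; length; allFin; cartesianProduct)
open import Data.List.Membership.Propositional using (_∈_; find)
open import Data.List.Membership.Propositional.Properties
  using (∈-map⁺; ∈-++⁺ˡ; ∈-++⁺ʳ; ∈-allFin; ∈-filter⁺; ∈-cartesianProduct⁺; ∈-∃++; ∈-++⁻)
open import Data.List.Properties
  using (filter-all; filter-reject; filter-++; length-++; length-map; length-tabulate;
         filter-none; map-++; upTo-∷ʳ)
open import Data.List.Relation.Binary.Permutation.Propositional as ↭ using (_↭_)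
open import Data.List.Relation.Binary.Permutation.Propositional.Properties
  using (filter-↭; ↭-length; shift; shifts) renaming (++⁺ˡ to ↭-++⁺ˡ)
open import Data.List.Relation.Binary.Sublist.Propositional
  using (_⊆_; []; _∷_; _∷ʳ_; ⊆-refl; ⊆-trans)
open import Data.List.Relation.Binary.Sublist.Propositional.Properties
  using (++⁺; filter-⊆; filter⁺; length-mono-≤)
open import Data.List.Relation.Unary.All as All using (All; all?)
import Data.List.Relation.Unary.All.Properties as All
open import Data.List.Relation.Unary.AllPairs using ([]; _∷_)
open import Data.List.Relation.Unary.Any using (here; there)
open import Data.List.Relation.Unary.Unique.Propositional using (Unique)
import Data.List.Relation.Unary.Unique.Propositional.Properties as Unique
open import Data.Nat.Base as ℕ using (zero; suc; z≤n; s≤s)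
open import Data.Nat.ListAction.Properties using (sum-++)
import Data.Nat.Properties as ℕ
import Data.Nat.Solver as ℕ-Solver
open import Data.Product.Base using (_×_; _,_; proj₂; swap)
open import Data.Rational.Base as ℚ using (toℚᵘ; NonNegative)
import Data.Rational.Properties as ℚ
import Data.Rational.Solver as ℚ-Solver
open import Data.Rational.Unnormalised.Base as ℚᵘ using (mkℚᵘ; *≡*)
import Data.Rational.Unnormalised.Properties as ℚᵘ
open import Data.Sum.Base as Sum using (_⊎_; inj₁; inj₂)
open import Function.Base using (_∘_)
open import Relation.Binary.Core using (Rel)
open import Relation.Binary.Definitions using (Decidable; Symmetric; tri<; tri≈; tri>)
open import Relation.Binary.PropositionalEquality hiding ([_])
open import Relation.Nullary.Decidable using (yes; no; _×-dec_; ¬?)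
open import Relation.Nullary.Negation using (¬_; contradiction)
open import Level using (0ℓ)
import Relation.Unary as U

-- Counting in filtered lists.

module _ {A : Set} where

  length-filter-⊎ : ∀ {P Q R : A → Set} (P? : U.Decidable P) (Q? : U.Decidable Q)
                    (R? : U.Decidable R) → (∀ {x} → P x → Q x ⊎ R x) → ∀ xs →
                    length (filter P? xs) ≤ length (filter Q? xs) ℕ.+ length (filter R? xs)
  length-filter-⊎ P? Q? R? P⇒ []       = z≤n
  length-filter-⊎ P? Q? R? P⇒ (x ∷ xs) with ih ← length-filter-⊎ P? Q? R? P⇒ xs | P? x | Q? x | R? x
  ... | yes p | no ¬q | no ¬r = contradiction (P⇒ p) Sum.[ ¬q , ¬r ]
  ... | yes _ | yes _ | no _  = s≤s ih
  ... | yes _ | yes _ | yes _ = s≤s (ℕ.≤-trans ih (ℕ.+-monoʳ-≤ _ (ℕ.n≤1+n _)))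
  ... | yes _ | no _  | yes _ = ℕ.≤-trans (s≤s ih) (ℕ.≤-reflexive (sym (ℕ.+-suc _ _)))
  ... | no _  | no _  | no _  = ih
  ... | no _  | yes _ | no _  = ℕ.m≤n⇒m≤1+n ih
  ... | no _  | no _  | yes _ = ℕ.≤-trans ih (ℕ.+-monoʳ-≤ _ (ℕ.n≤1+n _))
  ... | no _  | yes _ | yes _ = ℕ.m≤n⇒m≤1+n (ℕ.≤-trans ih (ℕ.+-monoʳ-≤ _ (ℕ.n≤1+n _)))

  length-filter-∩ : ∀ {P Q R : A → Set} (P? : U.Decidable P) (Q? : U.Decidable Q)
                    (R? : U.Decidable R) → (∀ {x} → P x → Q x → R x) → ∀ xs →
                    length (filter Q? (filter P? xs)) ≤ length (filter R? xs)
  length-filter-∩ P? Q? R? PQ⇒R []       = z≤n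
  length-filter-∩ P? Q? R? PQ⇒R (x ∷ xs) with ih ← length-filter-∩ P? Q? R? PQ⇒R xs | P? x
  length-filter-∩ P? Q? R? PQ⇒R (x ∷ xs) | no _ with R? x
  ... | yes _ = ℕ.m≤n⇒m≤1+n ih
  ... | no  _ = ih
  length-filter-∩ P? Q? R? PQ⇒R (x ∷ xs) | yes p with Q? x | R? x
  ... | yes _ | yes _ = s≤s ih
  ... | yes q | no ¬r = contradiction (PQ⇒R p q) ¬r
  ... | no  _ | yes _ = ℕ.m≤n⇒m≤1+n ih
  ... | no  _ | no  _ = ih

  -- Pigeonhole: the elements with value below `k` split into `k` level sets, peeled off from the
  -- top value down. With `f` the colour, a bound on each colour class becomes a bound on the whole
  -- edge set.
  length-filter-< : ∀ (f : A → ℕ) b xs →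
                    (∀ a → length (filter (λ x → f x ℕ.≟ a) xs) ≤ b) →
                    ∀ k → length (filter (λ x → f x ℕ.<? k) xs) ≤ k ℕ.* b
  length-filter-< f b xs class≤b zero    =
    ℕ.≤-reflexive (cong length (filter-none (λ x → f x ℕ.<? 0) (All.universal (λ _ ()) xs)))
  length-filter-< f b xs class≤b (suc k) = ℕ.≤-trans
    (length-filter-⊎ (λ x → f x ℕ.<? suc k) (λ x → f x ℕ.≟ k) (λ x → f x ℕ.<? k)
      (λ { (s≤s fx≤k) → Sum.swap (ℕ.m≤n⇒m<n∨m≡n fx≤k) }) xs)
    (ℕ.+-mono-≤ (class≤b k) (length-filter-< f b xs class≤b k))

  length-filter-map : ∀ {B : Set} {P : B → Set} (P? : U.Decidable P) (f : A → B) xs →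
                      length (filter P? (map f xs)) ≡ length (filter (P? ∘ f) xs)
  length-filter-map P? f []       = refl
  length-filter-map P? f (x ∷ xs) with P? (f x)
  ... | yes _ = cong suc (length-filter-map P? f xs)
  ... | no  _ = length-filter-map P? f xs

  -- Each head `x` of `xs` is matched with one occurrence in `ys`, which is deleted. The tail of
  -- `xs` avoids `x`, so it still lies in what remains.
  Unique⇒length≤ : ∀ {xs ys : List A} → Unique xs → (∀ {x} → x ∈ xs → x ∈ ys) →
                   length xs ≤ length ys
  Unique⇒length≤ []                  _     = z≤n
  Unique⇒length≤ {x ∷ xs} (x∉ ∷ xs!) xs⊆ys with ∈-∃++ (xs⊆ys (here refl))
  ... | us , vs , refl = ℕ.≤-trans (s≤s (Unique⇒length≤ xs! xs⊆us++vs))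
                                   (ℕ.≤-reflexive (sym (↭-length (shift x us vs))))
    where
    xs⊆us++vs : ∀ {y} → y ∈ xs → y ∈ us ++ vs
    xs⊆us++vs y∈xs with ∈-++⁻ us (xs⊆ys (there y∈xs))
    ... | inj₁ y∈us         = ∈-++⁺ˡ y∈us
    ... | inj₂ (here y≡x)   = contradiction (sym y≡x) (All.lookup x∉ y∈xs)
    ... | inj₂ (there y∈vs) = ∈-++⁺ʳ us y∈vs

module _ {A B : Set} where

  length-cartesianProduct : ∀ (xs : List A) (ys : List B) →
                            length (cartesianProduct xs ys) ≡ length xs ℕ.* length ys
  length-cartesianProduct []       ys = refl
  length-cartesianProduct (x ∷ xs) ys = trans (length-++ (map (x ,_) ys))
    (cong₂ ℕ._+_ (length-map (x ,_) ys) (length-cartesianProduct xs ys))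

  -- `cartesianProduct` unfolds along its first list only. This splits off a column, so that a
  -- square can lose a row and a column together.
  cartesianProduct-∷ʳ-↭ : ∀ (xs : List A) (y : B) ys →
    cartesianProduct xs (y ∷ ys) ↭ map (_, y) xs ++ cartesianProduct xs ys
  cartesianProduct-∷ʳ-↭ []       y ys = ↭.refl
  cartesianProduct-∷ʳ-↭ (x ∷ xs) y ys = ↭.prep (x , y) (↭.↭-trans
    (↭-++⁺ˡ (map (x ,_) ys) (cartesianProduct-∷ʳ-↭ xs y ys))
    (shifts (map (x ,_) ys) (map (_, y) xs)))

-- Counting related pairs in a list.

x+[y+z]≡y+[x+z] : ∀ x y z → x ℕ.+ (y ℕ.+ z) ≡ y ℕ.+ (x ℕ.+ z)
x+[y+z]≡y+[x+z] = solve 3 (λ x y z → x :+ (y :+ z) := y :+ (x :+ z)) refl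
  where open ℕ-Solver.+-*-Solver

module _ {A : Set} where

  -- Counts each unordered pair once, for symmetric R.
  pairs : ∀ {R : Rel A 0ℓ} → Decidable R → List A → ℕ
  pairs R? []       = 0
  pairs R? (x ∷ xs) = length (filter (R? x) xs) ℕ.+ pairs R? xs

  module _ {R : Rel A 0ℓ} (R? : Decidable R) (R-sym : Symmetric R) where

    -- The delicate case is a swap of two neighbours: their pair is tested as `R x y` on one side
    -- and as `R y x` on the other, and symmetry makes the tests agree.
    pairs-↭ : ∀ {xs ys} → xs ↭ ys → pairs R? xs ≡ pairs R? ys
    pairs-↭ ↭.refl         = refl
    pairs-↭ (↭.prep x p)   = cong₂ ℕ._+_ (↭-length (filter-↭ (R? x) p)) (pairs-↭ p)
    pairs-↭ (↭.trans p q)  = trans (pairs-↭ p) (pairs-↭ q)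
    pairs-↭ (↭.swap {xs} {ys} x y p) with eqˣ ← ↭-length (filter-↭ (R? x) p)
      | eqʸ ← ↭-length (filter-↭ (R? y) p) | eq ← pairs-↭ p | R? x y | R? y x
    ... | yes r | no ¬r = contradiction (R-sym r) ¬r
    ... | no ¬r | yes r = contradiction (R-sym r) ¬r
    ... | yes _ | yes _ rewrite eqˣ | eqʸ | eq =
      cong suc (x+[y+z]≡y+[x+z] (length (filter (R? x) ys)) (length (filter (R? y) ys)) _)
    ... | no _  | no _  rewrite eqˣ | eqʸ | eq =
      x+[y+z]≡y+[x+z] (length (filter (R? x) ys)) (length (filter (R? y) ys)) _

    -- With `x` moved to the front, its degree is the head term of `pairs`. By irreflexivity the
    -- degree is the same when counted in the full list, `x` included.
    pairs-remove : (∀ {x} → ¬ R x x) → ∀ xs x ys →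
      pairs R? (xs ++ x ∷ ys) ≡
      length (filter (R? x) (xs ++ x ∷ ys)) ℕ.+ pairs R? (xs ++ ys)
    pairs-remove irrefl xs x ys = trans (pairs-↭ (shift x xs ys))
      (cong (ℕ._+ pairs R? (xs ++ ys)) (sym (trans
        (↭-length (filter-↭ (R? x) (shift x xs ys)))
        (cong length (filter-reject (R? x) irrefl)))))

  pairs-⊆ : ∀ {R : Rel A 0ℓ} (R? : Decidable R) {xs ys} → xs ⊆ ys → pairs R? xs ≤ pairs R? ys
  pairs-⊆ R? []         = z≤n
  pairs-⊆ R? (y ∷ʳ p)   = ℕ.≤-trans (pairs-⊆ R? p) (ℕ.m≤n+m _ _)
  pairs-⊆ R? (refl ∷ p) =
    ℕ.+-mono-≤ (length-mono-≤ (filter⁺ (R? _) (R? _) (λ { refl r → r }) p)) (pairs-⊆ R? p)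

  -- Links the count of unordered pairs to the ordered count in `#monochromatic`. The square over
  -- `x ∷ xs` consists of `(x , x)`, the rest of the row and of the column of `x`, and the square
  -- over `xs`; pairs involving `x` are charged to the row or the column.
  pairs≤length-filter-× : ∀ {R : Rel A 0ℓ} (R? : Decidable R)
    {T : A × A → Set} (T? : U.Decidable T) → (∀ {x y} → R x y → T (x , y) ⊎ T (y , x)) →
    ∀ xs → pairs R? xs ≤ length (filter T? (cartesianProduct xs xs))
  pairs≤length-filter-× R? T? R⇒T []       = z≤n
  pairs≤length-filter-× {R} R? {T} T? R⇒T (x ∷ xs) = begin
    length (filter (R? x) xs) ℕ.+ pairs R? xs
      ≤⟨ ℕ.+-mono-≤ (length-filter-⊎ (R? x) (T? ∘ (x ,_)) (T? ∘ (_, x)) R⇒T xs)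
                    (pairs≤length-filter-× R? T? R⇒T xs) ⟩
    length (filter (T? ∘ (x ,_)) xs) ℕ.+ length (filter (T? ∘ (_, x)) xs) ℕ.+ #T xs²
      ≡⟨ cong (ℕ._+ #T xs²) (cong₂ ℕ._+_ (length-filter-map T? (x ,_) xs)
                                         (length-filter-map T? (_, x) xs)) ⟨
    #T (map (x ,_) xs) ℕ.+ #T (map (_, x) xs) ℕ.+ #T xs²
      ≡⟨ ℕ.+-assoc (#T (map (x ,_) xs)) _ _ ⟩
    #T (map (x ,_) xs) ℕ.+ (#T (map (_, x) xs) ℕ.+ #T xs²)
      ≡⟨ cong (#T (map (x ,_) xs) ℕ.+_) (#T-++ (map (_, x) xs) xs²) ⟨
    #T (map (x ,_) xs) ℕ.+ #T (map (_, x) xs ++ xs²)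
      ≡⟨ cong (#T (map (x ,_) xs) ℕ.+_)
              (↭-length (filter-↭ T? (cartesianProduct-∷ʳ-↭ xs x xs))) ⟨
    #T (map (x ,_) xs) ℕ.+ #T (cartesianProduct xs (x ∷ xs))
      ≡⟨ #T-++ (map (x ,_) xs) (cartesianProduct xs (x ∷ xs)) ⟨
    #T (map (x ,_) xs ++ cartesianProduct xs (x ∷ xs))
      -- The corner `(x , x)` is the one entry of the square not yet included.
      ≤⟨ length-mono-≤ (filter⁺ T? T? (λ { refl t → t }) ((x , x) ∷ʳ ⊆-refl)) ⟩
    #T (cartesianProduct (x ∷ xs) (x ∷ xs)) ∎
    where
    open ℕ.≤-Reasoning
    xs² = cartesianProduct xs xs
    #T : List (A × A) → ℕ
    #T = length ∘ filter T?
    #T-++ : ∀ us vs → #T (us ++ vs) ≡ #T us ℕ.+ #T vs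
    #T-++ us vs = trans (cong length (filter-++ T? us vs)) (length-++ (filter T? us))

-- The deletion argument for a fixed colouring.

Σe : ℕ → ℕ → ℕ
Σe n m = sum (map (λ ℓ → e ℓ n) (upTo m))

Σe-suc : ∀ n m → Σe n (suc m) ≡ Σe n m ℕ.+ e m n
Σe-suc n m = begin
  Σe n (suc m)                      ≡⟨ cong (sum ∘ map e′) (upTo-∷ʳ m) ⟨
  sum (map e′ (upTo m ++ [ m ]))    ≡⟨ cong sum (map-++ e′ (upTo m) [ m ]) ⟩
  sum (map e′ (upTo m) ++ [ e′ m ]) ≡⟨ sum-++ (map e′ (upTo m)) [ e′ m ] ⟩
  Σe n m ℕ.+ (e′ m ℕ.+ 0)           ≡⟨ cong (Σe n m ℕ.+_) (ℕ.+-identityʳ _) ⟩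
  Σe n m ℕ.+ e m n                  ∎
  where
  open ≡-Reasoning
  e′ : ℕ → ℕ
  e′ ℓ = e ℓ n

module _ {k n} (c : Colouring k n) where

  -- Symmetric, unlike `MonochromaticCrossing`, so that filtering by `crossesSame? d` finds every
  -- crossing partner of `d` in its colour.
  CrossesSame : Rel (Segment n) 0ℓ
  CrossesSame d e = Crosses d e × c d ≡ c e

  crossesSame? : Decidable CrossesSame
  crossesSame? d e = crosses? d e ×-dec (c d Fin.≟ c e)

  crossesSame-sym : Symmetric CrossesSame
  crossesSame-sym (x , same) = Sum.swap x , sym same

  crossesSame-irrefl : ∀ {d} → ¬ CrossesSame d d
  crossesSame-irrefl (inj₁ (i<i , _) , _) = ℕ.<-irrefl refl i<i
  crossesSame-irrefl (inj₂ (i<i , _) , _) = ℕ.<-irrefl refl i<i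

  -- Discarding the sides cannot raise the count. Each crossing pair left is charged to the order in
  -- which it satisfies `Interleaves`.
  pairs≤#monochromatic : pairs crossesSame? (diagonals n) ≤ #monochromatic c
  pairs≤#monochromatic = ℕ.≤-trans
    (pairs-⊆ crossesSame? (filter-⊆ (λ d → ¬? (side? d)) (edges n)))
    (pairs≤length-filter-× crossesSame? (monochromaticCrossing? c)
      (λ { (inj₁ I , same) → inj₁ (I , same) ; (inj₂ I , same) → inj₂ (I , sym same) })
      (edges n))

  -- All crossings inside one colour class are monochromatic, so each class is a competitor in the
  -- maximum defining `e ℓ n`; there are `k` classes.
  length≤k*e : ∀ {G} ℓ → G ⊆ diagonals n → All (λ d → length (filter (crossesSame? d) G) ≤ ℓ) G →
               length G ≤ k ℕ.* e ℓ n
  length≤k*e {G} ℓ G⊆ G-ok = subst (_≤ k ℕ.* e ℓ n)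
    -- Every colour is below `k`, so this filter keeps all of `G`.
    (cong length (filter-all (λ d → toℕ (c d) ℕ.<? k) (All.universal (λ d → Fin.toℕ<n (c d)) G)))
    (length-filter-< (toℕ ∘ c) (e ℓ n) G class≤e k)
    where
    class≤e : ∀ a → length (filter (λ d → toℕ (c d) ℕ.≟ a) G) ≤ e ℓ n
    class≤e a = proj₂ (proj₂ (maxEdges-exists ℓ n)) _
      (filter c≟a G , ⊆-trans (filter-⊆ c≟a G) G⊆ , class-ok , refl)
      where
      c≟a : U.Decidable (λ d → toℕ (c d) ≡ a)
      c≟a d = toℕ (c d) ℕ.≟ a
      class-ok : AtMostCrossed ℓ (filter c≟a G)
      class-ok = All.zipWith
        (λ {d} (deg≤ℓ , cd≡a) → ℕ.≤-trans
          (length-filter-∩ c≟a (crosses? d) (crossesSame? d)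
            (λ ce≡a x → x , Fin.toℕ-injective (trans cd≡a (sym ce≡a))) G)
          deg≤ℓ)
        (All.filter⁺ c≟a G-ok , All.all-filter c≟a G)

  -- The bound `s` drives the recursion, because deleting an edge from the middle of `G` is not a
  -- structural descent. The subtracted term stands on the right to avoid truncated subtraction.
  m*length≤pairs+k*Σe : ∀ m s {G} → length G ≤ s → G ⊆ diagonals n →
                        m ℕ.* length G ≤ pairs crossesSame? G ℕ.+ k ℕ.* Σe n m
  m*length≤pairs+k*Σe zero    s _ _ = z≤n
  m*length≤pairs+k*Σe (suc m) s {G} G≤s G⊆
    with all? (λ d → length (filter (crossesSame? d) G) ℕ.≤? m) G
  -- No edge has more than `m` partners: `length≤k*e` pays for one copy of `length G` with the new
  -- summand `e m n`, and the case `m` pays for the rest.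
  ... | yes deg≤m = begin
    length G ℕ.+ m ℕ.* length G
      ≤⟨ ℕ.+-mono-≤ (length≤k*e m G⊆ deg≤m) (m*length≤pairs+k*Σe m s G≤s G⊆) ⟩
    k ℕ.* e m n ℕ.+ (pairs crossesSame? G ℕ.+ k ℕ.* Σe n m)
      ≡⟨ solve 4 (λ k e p S → k :* e :+ (p :+ k :* S) := p :+ k :* (S :+ e)) refl k (e m n) _ (Σe n m) ⟩
    pairs crossesSame? G ℕ.+ k ℕ.* (Σe n m ℕ.+ e m n)
      ≡⟨ cong (λ S → pairs crossesSame? G ℕ.+ k ℕ.* S) (Σe-suc n m) ⟨
    pairs crossesSame? G ℕ.+ k ℕ.* Σe n (suc m) ∎
    where
    open ℕ.≤-Reasoning
    open ℕ-Solver.+-*-Solver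
  -- Some `d` has at least `suc m` partners. Deleting it lowers the left side by exactly `suc m` and
  -- `pairs` by at least as much.
  ... | no ¬deg≤m with find (All.¬All⇒Any¬ (λ d → length (filter (crossesSame? d) G) ℕ.≤? m) G ¬deg≤m)
  ... | d , d∈G , deg≰m with ∈-∃++ d∈G
  -- Since `G` contains `d`, the bound `s` is a successor, and its predecessor bounds the remaining
  -- list.
  ... | us , vs , refl with s | subst (_≤ s) (↭-length (shift d us vs)) G≤s
  ... | suc s′ | s≤s G′≤s′ = begin
    suc m ℕ.* length (us ++ d ∷ vs)
      ≡⟨ cong (suc m ℕ.*_) (↭-length (shift d us vs)) ⟩
    suc m ℕ.* suc (length (us ++ vs))
      ≡⟨ ℕ.*-suc (suc m) _ ⟩
    suc m ℕ.+ suc m ℕ.* length (us ++ vs)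
      ≤⟨ ℕ.+-mono-≤ (ℕ.≰⇒> deg≰m) (m*length≤pairs+k*Σe (suc m) s′ G′≤s′
           (⊆-trans (++⁺ (⊆-refl {x = us}) (d ∷ʳ ⊆-refl)) G⊆)) ⟩
    length (filter (crossesSame? d) (us ++ d ∷ vs)) ℕ.+
      (pairs crossesSame? (us ++ vs) ℕ.+ k ℕ.* Σe n (suc m))
      ≡⟨ ℕ.+-assoc (length (filter (crossesSame? d) (us ++ d ∷ vs))) _ _ ⟨
    length (filter (crossesSame? d) (us ++ d ∷ vs)) ℕ.+
      pairs crossesSame? (us ++ vs) ℕ.+ k ℕ.* Σe n (suc m)
      ≡⟨ cong (ℕ._+ k ℕ.* Σe n (suc m))
              (pairs-remove crossesSame? crossesSame-sym crossesSame-irrefl us d vs) ⟨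
    pairs crossesSame? (us ++ d ∷ vs) ℕ.+ k ℕ.* Σe n (suc m) ∎
    where open ℕ.≤-Reasoning

m*#diagonals≤ν+k*Σe : ∀ n k .{{_ : NonZero k}} m → m ℕ.* length (diagonals n) ≤
                      ν k n ℕ.+ k ℕ.* Σe n m
m*#diagonals≤ν+k*Σe n k m with bookCrossingNumber-exists k n
-- Here `c` is an optimal colouring, which attains `ν k n`.
... | _ , (c , refl) , _ = ℕ.≤-trans (m*length≤pairs+k*Σe c m _ ℕ.≤-refl ⊆-refl)
                                     (ℕ.+-monoˡ-≤ _ (pairs≤#monochromatic c))

-- A lower bound for the number of diagonals.

-- A cover of the sides with exactly `n` entries. For one vertex it holds a loop and for two a
-- repetition, harmless since only membership and length are used.
sides : ∀ n → List (Segment n)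
sides zero    = []
sides (suc n) = (Fin.zero , Fin.fromℕ n) ∷ map (λ i → inject₁ i , Fin.suc i) (allFin n)

length-allFin : ∀ n → length (allFin n) ≡ n
length-allFin n = length-tabulate {n = n} (λ i → i)

length-sides : ∀ n → length (sides n) ≡ n
length-sides zero    = refl
length-sides (suc n) = cong suc (trans (length-map _ (allFin n)) (length-allFin n))

side∈sides : ∀ {n} (i j : Fin n) → Side (i , j) → (i , j) ∈ sides n
side∈sides {suc n} i          (Fin.suc j) (inj₁ si≡sj)
  rewrite Fin.toℕ-injective (trans (ℕ.suc-injective si≡sj) (sym (Fin.toℕ-inject₁ j))) =
  there (∈-map⁺ _ (∈-allFin j))
side∈sides {suc n} Fin.zero j (inj₂ (_ , sj≡sn))
  rewrite Fin.toℕ-injective (trans (ℕ.suc-injective sj≡sn) (sym (Fin.toℕ-fromℕ n))) = here refl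

-- Each of the n² ordered pairs is a loop, or a side or diagonal in one of its two
-- orientations.
n*n≤2*#diagonals+3*n : ∀ n → n ℕ.* n ≤ 2 ℕ.* length (diagonals n) ℕ.+ 3 ℕ.* n
n*n≤2*#diagonals+3*n n = begin
  n ℕ.* n
    ≡⟨ cong₂ ℕ._*_ (length-allFin n) (length-allFin n) ⟨
  length (allFin n) ℕ.* length (allFin n)
    ≡⟨ length-cartesianProduct (allFin n) (allFin n) ⟨
  length (cartesianProduct (allFin n) (allFin n))
    ≤⟨ Unique⇒length≤ (Unique.cartesianProduct⁺ (Unique.allFin⁺ n) (Unique.allFin⁺ n))
                      (λ {(i , j)} _ → covered i j) ⟩
  length (loops ++ chords ++ map swap chords)
    ≡⟨ trans (length-++ loops) (cong (length loops ℕ.+_) (length-++ chords)) ⟩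
  length loops ℕ.+ (length chords ℕ.+ length (map swap chords))
    ≡⟨ cong₂ ℕ._+_ (trans (length-map _ (allFin n)) (length-allFin n))
                   (cong (length chords ℕ.+_) (length-map swap chords)) ⟩
  n ℕ.+ (length chords ℕ.+ length chords)
    ≡⟨ cong (λ l → n ℕ.+ (l ℕ.+ l)) (trans (length-++ (sides n)) (cong (ℕ._+ D) (length-sides n))) ⟩
  n ℕ.+ (n ℕ.+ D ℕ.+ (n ℕ.+ D))
    -- The three copies of `n` come from the loops and from the sides in both orientations.
    ≡⟨ solve 2 (λ n D → n :+ (n :+ D :+ (n :+ D)) := con 2 :* D :+ con 3 :* n) refl n D ⟩
  2 ℕ.* D ℕ.+ 3 ℕ.* n ∎
  where
  open ℕ.≤-Reasoning
  open ℕ-Solver.+-*-Solver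
  D = length (diagonals n)
  loops chords : List (Segment n)
  loops  = map (λ i → i , i) (allFin n)
  chords = sides n ++ diagonals n
  edge∈chords : ∀ i j → i Fin.< j → (i , j) ∈ chords
  edge∈chords i j i<j with side? (i , j)
  ... | yes side = ∈-++⁺ˡ (side∈sides i j side)
  ... | no ¬side = ∈-++⁺ʳ (sides n) (∈-filter⁺ (λ d → ¬? (side? d))
    (∈-filter⁺ (λ (i , j) → i Fin.<? j) (∈-cartesianProduct⁺ (∈-allFin i) (∈-allFin j)) i<j) ¬side)
  covered : ∀ i j → (i , j) ∈ loops ++ chords ++ map swap chords
  covered i j with Fin.<-cmp i j
  ... | tri< i<j _ _ = ∈-++⁺ʳ loops (∈-++⁺ˡ (edge∈chords i j i<j))
  ... | tri≈ _ refl _ = ∈-++⁺ˡ (∈-map⁺ _ (∈-allFin i))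
  ... | tri> _ _ j<i = ∈-++⁺ʳ loops (∈-++⁺ʳ chords (∈-map⁺ swap (edge∈chords j i j<i)))

-- Transfer to the rationals and conclusion.

fromℕ-+ : ∀ a b → fromℕ (a ℕ.+ b) ≡ fromℕ a ℚ.+ fromℕ b
fromℕ-+ a b = ℚ.toℚᵘ-injective (ℚᵘ.≃-trans
  (*≡* (cong (ℤ._* + 1) (sym (cong₂ ℤ._+_ (ℤ.*-identityʳ (+ a)) (ℤ.*-identityʳ (+ b))))))
  (ℚᵘ.≃-sym (ℚ.toℚᵘ-homo-+ (fromℕ a) (fromℕ b))))

fromℕ-* : ∀ a b → fromℕ (a ℕ.* b) ≡ fromℕ a * fromℕ b
fromℕ-* a b = ℚ.toℚᵘ-injective (ℚᵘ.≃-trans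
  (*≡* (cong (ℤ._* + 1) (ℤ.pos-* a b)))
  (ℚᵘ.≃-sym (ℚ.toℚᵘ-homo-* (fromℕ a) (fromℕ b))))

fromℕ-mono-≤ : ∀ {a b} → a ≤ b → fromℕ a ℚ.≤ fromℕ b
fromℕ-mono-≤ a≤b = ℚ.*≤* (ℤ.*-monoʳ-≤-nonNeg (+ 1) (ℤ.+≤+ a≤b))

m/2*2≡m : ∀ m → (+ m / 2) * fromℕ 2 ≡ fromℕ m
m/2*2≡m m = ℚ.toℚᵘ-injective (ℚᵘ.≃-trans (ℚ.toℚᵘ-homo-* (+ m / 2) (fromℕ 2)) (ℚᵘ.≃-trans
  -- The fraction `+ m / 2` may have been reduced; it is replaced by the unreduced one, as `mkℚᵘ`
  -- stores the denominator minus one.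
  (ℚᵘ.*-congʳ {toℚᵘ (fromℕ 2)} (ℚ.toℚᵘ-fromℚᵘ (mkℚᵘ (+ m) 1)))
  (*≡* (ℤ.*-assoc (+ m) (+ 2) (+ 1)))))

theorem3 : ∀ (n k : ℕ) .{{_ : NonZero k}} → 3 ≤ n → 3 ≤ k → ∀ (m : ℕ) →
    fromℕ (ν k n) ≥
    (+ m / 2) * fromℕ n * (fromℕ n - fromℕ 3)
    - fromℕ k * fromℕ (sum (map (λ ℓ → e ℓ n) (upTo m)))
theorem3 n k _ _ m = begin
  p * N * (N - fromℕ 3) - K * S
    ≡⟨ solve 5 (λ p N t K S → p :* N :* (N :- t) :- K :* S :=
                              p :* (N :* N) :- (p :* (t :* N) :+ K :* S))
             refl p N (fromℕ 3) K S ⟩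
  p * (N * N) - (p * (fromℕ 3 * N) ℚ.+ K * S)
    -- The square of `N` is traded for diagonals, which is allowed since `p` is nonnegative; the
    -- terms in `fromℕ 3 * N` then cancel.
    ≤⟨ ℚ.+-monoˡ-≤ (ℚ.- (p * (fromℕ 3 * N) ℚ.+ K * S)) (ℚ.*-monoˡ-≤-nonNeg p N²≤) ⟩
  p * (fromℕ 2 * D ℚ.+ fromℕ 3 * N) - (p * (fromℕ 3 * N) ℚ.+ K * S)
    ≡⟨ solve 7 (λ p N t K S D w → p :* (w :* D :+ t :* N) :- (p :* (t :* N) :+ K :* S) :=
                                  p :* w :* D :- K :* S)
             refl p N (fromℕ 3) K S D (fromℕ 2) ⟩
  p * fromℕ 2 * D - K * S
    ≡⟨ cong (λ q → q * D - K * S) (m/2*2≡m m) ⟩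
  fromℕ m * D - K * S
    ≤⟨ ℚ.+-monoˡ-≤ (ℚ.- (K * S)) mD≤ ⟩
  V ℚ.+ K * S - K * S
    ≡⟨ solve 2 (λ V x → V :+ x :- x := V) refl V (K * S) ⟩
  V ∎
  where
  open ℚ.≤-Reasoning
  open ℚ-Solver.+-*-Solver
  p = + m / 2
  N = fromℕ n
  K = fromℕ k
  S = fromℕ (Σe n m)
  D = fromℕ (length (diagonals n))
  V = fromℕ (ν k n)
  instance
    p≥0 : NonNegative p
    p≥0 = ℚ.normalize-nonNeg m 2
  N²≤ : N * N ℚ.≤ fromℕ 2 * D ℚ.+ fromℕ 3 * N
  N²≤ = subst₂ ℚ._≤_ (fromℕ-* n n)
    (trans (fromℕ-+ (2 ℕ.* length (diagonals n)) (3 ℕ.* n))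
           (cong₂ ℚ._+_ (fromℕ-* 2 (length (diagonals n))) (fromℕ-* 3 n)))
    (fromℕ-mono-≤ (n*n≤2*#diagonals+3*n n))
  mD≤ : fromℕ m * D ℚ.≤ V ℚ.+ K * S
  mD≤ = subst₂ ℚ._≤_ (fromℕ-* m (length (diagonals n)))
    (trans (fromℕ-+ (ν k n) _) (cong (V ℚ.+_) (fromℕ-* k _)))
    (fromℕ-mono-≤ (m*#diagonals≤ν+k*Σe n k m))
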